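{- Let $(R_1,\mathcal L_1)$ and $(R_2,\mathcal L_2)$ be recursive rings with a recursive interpretation of a language. Let $\phi:R_1\to R_2$ be a bijective recursive function. Suppose that $d:R_1\to R_2$ is given by a Diophantine expression in $\phi$. Then $d$ is a recursive function.
   Context: A recursive ring is a ring $R$ with a fixed recursive representation, i.e. an injection $j:R\to\mathbb N$ with recursive image for which addition and multiplication are recursive; subsets of $R^k$ are recursive if their images under $j^k$ are, and a function $R_1\to R_2$ is recursive if its translation $j_2\circ f\circ j_1^{ -1}$ is the restriction of a recursive function. A language $\mathcal L$ (constants, functions, relations; always containing a constant $0$ and equality) has a recursive interpretation in $R$ if all its functions are interpreted by recursive functions and all its relations by recursive sets. Terms are built from constants and variables using functions of $\mathcal L$; basic formulas are $(t_1,\ldots,t_k)\in R'$ with $R'\in\mathcal L$ a $k$-ary relation (possibly equality). A map $d:R_1\to R_2$ is given by a Diophantine expression in $\phi:R_1\to R_2$ if there are basic $\mathcal L_2$-formulas $f_1,\ldots,f_n$ and an $l$ such that for all $x\in R_1$, $z\in R_2$: $d(x)=z\iff\exists\vec y\in R_2^{l},\ \forall1\le i\le n,\ f_i(\phi(x),\vec y,z)$. -}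

module Defs where

open import Algebra.Bundles using (Ring)
open import Data.Fin.Base using (Fin)
open import Data.Nat.Base using (ℕ; zero; suc; _<_)
open import Data.Product.Base using (Σ-syntax; ∃-syntax; _×_)
open import Data.Sum.Base using (_⊎_)
open import Data.Vec.Base using (Vec; []; _∷_; _∷ʳ_; head; lookup; map; tabulate)
import Data.Vec.Relation.Binary.Equality.Setoid as VecEquality
open import Function.Bundles using (Func; Injection; _⇔_)
open import Level using (Level; _⊔_) renaming (suc to lsuc)
open import Relation.Binary.Bundles using (Setoid)
open import Relation.Binary.Definitions using (_Respects_)
open import Relation.Binary.PropositionalEquality.Core using (_≡_; _≢_; _≗_)
open import Relation.Binary.PropositionalEquality.Properties using (setoid)
open import Relation.Nullary.Negation.Core using (¬_)
open import Relation.Unary using (Pred; U)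

-- The general recursive functions: the least class of total functions ℕᵏ → ℕ
-- containing the initial functions and closed under composition, primitive
-- recursion and minimisation of regular functions.  Functions defined by
-- primitive recursion or minimisation are specified by their defining
-- conditions; `ext` makes the class invariant under pointwise equality.

data Recursive : ∀ {k : ℕ} → (Vec ℕ k → ℕ) → Set where
  zer  : Recursive {0} (λ _ → zero)
  succ : Recursive {1} (λ v → suc (head v))
  proj : ∀ {k : ℕ} (i : Fin k) → Recursive {k} (λ v → lookup v i)
  comp : ∀ {k m : ℕ} {g : Vec ℕ m → ℕ} {h : Fin m → Vec ℕ k → ℕ} →
         Recursive g → (∀ i → Recursive (h i)) →
         Recursive (λ v → g (tabulate (λ i → h i v)))
  prec : ∀ {k : ℕ} {g : Vec ℕ k → ℕ} {h : Vec ℕ (suc (suc k)) → ℕ}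
         {f : Vec ℕ (suc k) → ℕ} →
         Recursive g → Recursive h →
         (∀ v → f (zero ∷ v) ≡ g v) →
         (∀ n v → f (suc n ∷ v) ≡ h (n ∷ f (n ∷ v) ∷ v)) →
         Recursive f
  mini : ∀ {k : ℕ} {g : Vec ℕ (suc k) → ℕ} {f : Vec ℕ k → ℕ} →
         Recursive g →
         (∀ v → g (f v ∷ v) ≡ zero) →
         (∀ v n → n < f v → g (n ∷ v) ≢ zero) →
         Recursive f
  ext  : ∀ {k : ℕ} {f g : Vec ℕ k → ℕ} → f ≗ g → Recursive f → Recursive g

RecursiveSet : ∀ {p : Level} {k : ℕ} → Pred (Vec ℕ k) p → Set p
RecursiveSet {k = k} A =
  Σ[ χ ∈ (Vec ℕ k → ℕ) ]
    Recursive χ × (∀ v → (χ v ≡ 1 × A v) ⊎ (χ v ≡ 0 × ¬ A v))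

Coding : ∀ {a ℓ : Level} → Setoid a ℓ → Set (a ⊔ ℓ)
Coding A = Injection A (setoid ℕ)

module _ {a ℓ : Level} {A : Setoid a ℓ} (j : Coding A) where
  open Setoid A using (Carrier)
  open Injection j using (to)

  Image : ∀ {p : Level} {k : ℕ} → Pred (Vec Carrier k) p → Pred (Vec ℕ k) (a ⊔ p)
  Image {k = k} S n = Σ[ v ∈ Vec Carrier k ] S v × map to v ≡ n

  RecursiveSubset : ∀ {p : Level} {k : ℕ} → Pred (Vec Carrier k) p → Set (a ⊔ p)
  RecursiveSubset S = RecursiveSet (Image S)

-- `g` extends j₂ ∘ f ∘ (j₁ᵏ)⁻¹, a function on the image of j₁ᵏ, to all of ℕᵏ.

RecursiveOperation : ∀ {a ℓ b m : Level} {A : Setoid a ℓ} {B : Setoid b m} →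
                     Coding A → Coding B → ∀ {k : ℕ} →
                     (Vec (Setoid.Carrier A) k → Setoid.Carrier B) → Set a
RecursiveOperation j₁ j₂ {k} f =
  Σ[ g ∈ (Vec ℕ k → ℕ) ]
    Recursive g ×
    (∀ v → g (map (Injection.to j₁) v) ≡ Injection.to j₂ (f v))

record RecursiveRing (c ℓ : Level) : Set (lsuc (c ⊔ ℓ)) where
  field
    ring : Ring c ℓ
  open Ring ring public
    using (Carrier; _≈_; _+_; _*_; 0#) renaming (setoid to ≈-setoid)
  field
    code            : Coding ≈-setoid
    image-recursive : RecursiveSubset code {k = 1} U
    +-recursive     : RecursiveOperation code code {2} (λ { (x ∷ y ∷ []) → x + y })
    *-recursive     : RecursiveOperation code code {2} (λ { (x ∷ y ∷ []) → x * y })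

RecursiveMap : ∀ {c₁ ℓ₁ c₂ ℓ₂ : Level}
               (R₁ : RecursiveRing c₁ ℓ₁) (R₂ : RecursiveRing c₂ ℓ₂) →
               (RecursiveRing.Carrier R₁ → RecursiveRing.Carrier R₂) → Set c₁
RecursiveMap R₁ R₂ f =
  RecursiveOperation (RecursiveRing.code R₁) (RecursiveRing.code R₂) {1}
    (λ v → f (head v))

record Language (s : Level) : Set (lsuc s) where
  field
    Const : Set s
    Fun   : ℕ → Set s
    Rel   : ℕ → Set s
    null  : Const
    equal : Rel 2

module _ {s : Level} (L : Language s) where
  open Language L

  data Term (n : ℕ) : Set s where
    var : Fin n → Term n
    con : Const → Term n
    app : ∀ {k : ℕ} → Fun k → Vec (Term n) k → Term n

  data BasicFormula (n : ℕ) : Set s where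
    rel : ∀ {k : ℕ} → Rel k → Vec (Term n) k → BasicFormula n

record RecursiveInterpretation {s c ℓ : Level} (p : Level)
                               (L : Language s) (R : RecursiveRing c ℓ)
                               : Set (s ⊔ c ⊔ ℓ ⊔ lsuc p) where
  open Language L
  open RecursiveRing R
  open VecEquality ≈-setoid using (_≋_; ≋-setoid)
  field
    ⟦_⟧ᶜ : Const → Carrier
    ⟦_⟧ᶠ : ∀ {k : ℕ} → Fun k → Func (≋-setoid k) ≈-setoid
    ⟦_⟧ʳ : ∀ {k : ℕ} → Rel k → Pred (Vec Carrier k) p

    rel-respects : ∀ {k : ℕ} (r : Rel k) → ⟦ r ⟧ʳ Respects _≋_

    null-zero      : ⟦ null ⟧ᶜ ≈ 0#
    equal-equality : ∀ x y → ⟦ equal ⟧ʳ (x ∷ y ∷ []) ⇔ x ≈ y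

    fun-recursive : ∀ {k : ℕ} (f : Fun k) → RecursiveOperation code code (Func.to ⟦ f ⟧ᶠ)
    rel-recursive : ∀ {k : ℕ} (r : Rel k) → RecursiveSubset code ⟦ r ⟧ʳ

module _ {s c ℓ p : Level} {L : Language s} {R : RecursiveRing c ℓ}
         (I : RecursiveInterpretation p L R) where
  open RecursiveRing R using (Carrier)
  open RecursiveInterpretation I

  mutual
    evalTerm : ∀ {n : ℕ} → Vec Carrier n → Term L n → Carrier
    evalTerm ρ (var i)    = lookup ρ i
    evalTerm ρ (con a)    = ⟦ a ⟧ᶜ
    evalTerm ρ (app f ts) = Func.to ⟦ f ⟧ᶠ (evalTerms ρ ts)

    evalTerms : ∀ {n k : ℕ} → Vec Carrier n → Vec (Term L n) k → Vec Carrier k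
    evalTerms ρ []       = []
    evalTerms ρ (t ∷ ts) = evalTerm ρ t ∷ evalTerms ρ ts

  Holds : ∀ {n : ℕ} → BasicFormula L n → Vec Carrier n → Set p
  Holds (rel r ts) ρ = ⟦ r ⟧ʳ (evalTerms ρ ts)

DiophantineIn : ∀ {s p c₁ ℓ₁ c₂ ℓ₂ : Level}
                (R₁ : RecursiveRing c₁ ℓ₁) (R₂ : RecursiveRing c₂ ℓ₂)
                {L₂ : Language s} → RecursiveInterpretation p L₂ R₂ →
                (φ d : RecursiveRing.Carrier R₁ → RecursiveRing.Carrier R₂) →
                Set (s ⊔ p ⊔ c₁ ⊔ c₂ ⊔ ℓ₂)
DiophantineIn R₁ R₂ {L₂} I₂ φ d =
  ∃[ n ] ∃[ l ]
  Σ[ f ∈ (Fin n → BasicFormula L₂ (suc (suc l))) ]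
    (∀ x z → d x ≈ z ⇔ (Σ[ y ∈ Vec Carrier l ] ∀ i → Holds I₂ (f i) (φ x ∷ (y ∷ʳ z))))
  where open RecursiveRing R₂ using (Carrier; _≈_)

{-# OPTIONS --safe #-}
module Submission where

-- Write n for the code of x.  The graph of d is a projection of a recursive set:
-- a term of L₂ induces a recursive function on codes, so the tuples of codes that
-- satisfy all the formulas fᵢ form a recursive set, and the Diophantine expression
-- says that z is the code of d x precisely when (φ̂ n, ȳ, z) lies in this set for
-- some tuple ȳ of codes, where φ̂ is a recursive function realising φ on codes.
--
-- Hence d x is computed by searching for (ȳ, z).  The search is a minimisation
-- only if it succeeds for every n, so it is also allowed to stop whenever n is not
-- the code of an element of R₁, a recursive condition.  Instead of coding tuples
-- by numbers, `search` first minimises a common bound b for some solution (ȳ, z),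
-- which is legitimate since recursive sets are closed under bounded existential
-- quantification, and then takes the least z that belongs to a solution with ȳ
-- below b.  By the expression for d, any z found in this way is the code of d x.

open import Defs
open import Data.Empty using (⊥-elim)
open import Data.Fin.Base using (Fin; zero; suc)
open import Data.Nat.Base using (ℕ; zero; suc; _+_; _<_; _⊔_; s<s)
open import Data.Nat.Properties using (<-≤-trans; n<1+n; m<n⇒m<1+n; m≤m⊔n;
  m≤n⊔m; m<1+n⇒m<n∨m≡n)
open import Data.Product.Base using (Σ-syntax; ∃-syntax; ∃₂; _×_; _,_; proj₁; proj₂)
open import Data.Sum.Base using (_⊎_; inj₁; inj₂)
open import Data.Unit.Base using (tt)
open import Data.Vec.Base using (Vec; []; _∷_; [_]; _∷ʳ_; _++_; head; tail; lookup; map; take; drop; replicate; initLast)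
open import Data.Vec.Properties using (tabulate∘lookup; lookup-map; map-∷ʳ; ∷-injectiveˡ; ∷-injectiveʳ; ∷ʳ-injectiveʳ)
open import Data.Vec.Relation.Unary.All as All using (All; []; _∷_)
import Data.Vec.Relation.Binary.Equality.Setoid as VecEquality
open import Function.Base using (_∘_; id; const)
open import Function.Bundles using (Func; Bijection; Injection; Equivalence)
open import Level using (Level)
open import Relation.Binary.Bundles using (Setoid)
open import Relation.Binary.Definitions using (_Respects_)
open import Relation.Binary.PropositionalEquality using (_≡_; _≢_; _≗_; refl; sym; trans; cong; cong₂; subst)
open import Relation.Nullary.Negation.Core using (¬_)
open import Relation.Unary using (Pred; U; _∩_; _∪_; ∁; _≐_)

private variable
  a ℓ p q : Level
  k l m n : ℕ

-- Recursive functions with several components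

-- A function into ℕᵐ is recursive if each of its components is.  This is a record
-- type so that F can be inferred from it.
record RecursiveVec {k m : ℕ} (F : Vec ℕ k → Vec ℕ m) : Set where
  constructor componentwise
  field
    component : ∀ i → Recursive (λ v → lookup (F v) i)

open RecursiveVec

∘-recursive : {g : Vec ℕ m → ℕ} {F : Vec ℕ k → Vec ℕ m} →
              Recursive g → RecursiveVec F → Recursive (g ∘ F)
∘-recursive {g = g} {F} g-rec F-rec =
  ext (λ v → cong g (tabulate∘lookup (F v)))
      (comp {g = g} {h = λ i v → lookup (F v) i} g-rec (component F-rec))

∘-recursiveVec : {G : Vec ℕ m → Vec ℕ n} {F : Vec ℕ k → Vec ℕ m} →
                 RecursiveVec G → RecursiveVec F → RecursiveVec (G ∘ F)
∘-recursiveVec G-rec F-rec =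
  componentwise (λ i → ∘-recursive (component G-rec i) F-rec)

extVec : {F G : Vec ℕ k → Vec ℕ m} → F ≗ G → RecursiveVec F → RecursiveVec G
extVec F≗G F-rec = componentwise λ i →
  ext (λ v → cong (λ w → lookup w i) (F≗G v)) (component F-rec i)

id-recursive : RecursiveVec (id {A = Vec ℕ k})
id-recursive = componentwise proj

[]-recursive : RecursiveVec {k} (const [])
[]-recursive = componentwise λ ()

∷-recursive : {f : Vec ℕ k → ℕ} {F : Vec ℕ k → Vec ℕ m} →
              Recursive f → RecursiveVec F → RecursiveVec (λ v → f v ∷ F v)
∷-recursive f-rec F-rec = componentwise λ where
  zero    → f-rec
  (suc i) → component F-rec i

head-recursive : Recursive {suc k} head
head-recursive = ext (λ { (_ ∷ _) → refl }) (proj zero)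

tail-recursive : RecursiveVec {suc k} tail
tail-recursive = componentwise λ i → ext (λ { (_ ∷ _) → refl }) (proj (suc i))

∷ʳ-recursive : {F : Vec ℕ k → Vec ℕ m} {f : Vec ℕ k → ℕ} →
               RecursiveVec F → Recursive f → RecursiveVec (λ v → F v ∷ʳ f v)
∷ʳ-recursive {m = zero} {F} {f} F-rec f-rec =
  extVec (λ v → []-∷ʳ (F v) (f v)) (∷-recursive f-rec []-recursive)
  where
  []-∷ʳ : (w : Vec ℕ 0) (x : ℕ) → [ x ] ≡ w ∷ʳ x
  []-∷ʳ [] x = refl
∷ʳ-recursive {m = suc m} {F} {f} F-rec f-rec =
  extVec (λ v → ∷-∷ʳ (F v) (f v))
         (∷-recursive (∘-recursive head-recursive F-rec)
                      (∷ʳ-recursive (∘-recursiveVec tail-recursive F-rec) f-rec))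
  where
  ∷-∷ʳ : (w : Vec ℕ (suc m)) (x : ℕ) → head w ∷ (tail w ∷ʳ x) ≡ w ∷ʳ x
  ∷-∷ʳ (_ ∷ _) x = refl

drop-recursive : ∀ l → RecursiveVec (drop l {k})
drop-recursive zero    = id-recursive
drop-recursive (suc l) =
  extVec (λ { (_ ∷ _) → refl }) (∘-recursiveVec (drop-recursive l) tail-recursive)

take-recursive : ∀ l → RecursiveVec (take l {k})
take-recursive zero    = []-recursive
take-recursive (suc l) =
  extVec (λ { (_ ∷ _) → refl })
         (∷-recursive head-recursive (∘-recursiveVec (take-recursive l) tail-recursive))

take-++ : ∀ (v : Vec ℕ l) (w : Vec ℕ k) → take l (v ++ w) ≡ v
take-++ []      w = refl
take-++ (x ∷ v) w = cong (x ∷_) (take-++ v w)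

drop-++ : ∀ (v : Vec ℕ l) (w : Vec ℕ k) → drop l (v ++ w) ≡ w
drop-++ []      w = refl
drop-++ (x ∷ v) w = drop-++ v w

-- The action of F on a tuple whose first l entries are left unchanged.
under : ∀ l → (Vec ℕ m → Vec ℕ k) → Vec ℕ (l + m) → Vec ℕ (l + k)
under zero    F w = F w
under (suc l) F w = head w ∷ under l F (tail w)

under-++ : ∀ (F : Vec ℕ m → Vec ℕ k) (v : Vec ℕ l) w → under l F (v ++ w) ≡ v ++ F w
under-++ F []      w = refl
under-++ F (x ∷ v) w = cong (x ∷_) (under-++ F v w)

under-recursive : ∀ l {F : Vec ℕ m → Vec ℕ k} → RecursiveVec F → RecursiveVec (under l F)
under-recursive zero    F-rec = F-rec
under-recursive (suc l) F-rec =
  ∷-recursive head-recursive (∘-recursiveVec (under-recursive l F-rec) tail-recursive)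

const-recursive : ∀ c → Recursive {k} (const c)
const-recursive zero    = comp {g = const 0} {h = λ ()} zer (λ ())
const-recursive (suc c) = comp {h = λ _ → const c} succ (λ _ → const-recursive c)

-- Boolean operations on characteristic values: 0 is false, all else is true

not : ℕ → ℕ
not zero    = 1
not (suc _) = 0

and : ℕ → ℕ → ℕ
and zero    _ = 0
and (suc _) x = x

or : ℕ → ℕ → ℕ
or zero    x = x
or (suc _) _ = 1

not-recursive : {f : Vec ℕ k → ℕ} → Recursive f → Recursive (not ∘ f)
not-recursive f-rec = ∘-recursive not′ (∷-recursive f-rec []-recursive)
  where
  not′ : Recursive {1} (not ∘ head)
  not′ = prec (const-recursive 1) (const-recursive 0) (λ _ → refl) (λ _ _ → refl)

and-recursive : {f g : Vec ℕ k → ℕ} → Recursive f → Recursive g →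
                Recursive (λ v → and (f v) (g v))
and-recursive f-rec g-rec = ∘-recursive and′ (∷-recursive f-rec (∷-recursive g-rec []-recursive))
  where
  and′ : Recursive {2} (λ v → and (head v) (head (tail v)))
  and′ = prec (const-recursive 0) (proj (suc (suc zero)))
              (λ _ → refl) (λ { _ (_ ∷ _) → refl })

or-recursive : {f g : Vec ℕ k → ℕ} → Recursive f → Recursive g →
               Recursive (λ v → or (f v) (g v))
or-recursive f-rec g-rec = ∘-recursive or′ (∷-recursive f-rec (∷-recursive g-rec []-recursive))
  where
  or′ : Recursive {2} (λ v → or (head v) (head (tail v)))
  or′ = prec (proj zero) (const-recursive 1) (λ { (_ ∷ _) → refl }) (λ _ _ → refl)

-- Closure properties of recursive sets

-- The value x is 1 if P holds and 0 if it does not.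
Reflects : ℕ → Set p → Set p
Reflects x P = (x ≡ 1 × P) ⊎ (x ≡ 0 × ¬ P)

≐-recursiveSet : {A : Pred (Vec ℕ k) p} {B : Pred (Vec ℕ k) q} →
                 A ≐ B → RecursiveSet A → RecursiveSet B
≐-recursiveSet {A = A} {B} (A⊆B , B⊆A) (χ , χ-rec , χ-A) = χ , χ-rec , χ-B
  where
  χ-B : ∀ v → Reflects (χ v) (B v)
  χ-B v with χ-A v
  ... | inj₁ (χ≡1 , Av)  = inj₁ (χ≡1 , A⊆B Av)
  ... | inj₂ (χ≡0 , ¬Av) = inj₂ (χ≡0 , ¬Av ∘ B⊆A)

preimage-recursiveSet : {A : Pred (Vec ℕ m) p} {F : Vec ℕ k → Vec ℕ m} →
                        RecursiveVec F → RecursiveSet A → RecursiveSet (A ∘ F)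
preimage-recursiveSet {F = F} F-rec (χ , χ-rec , χ-A) =
  χ ∘ F , ∘-recursive χ-rec F-rec , χ-A ∘ F

∁-recursiveSet : {A : Pred (Vec ℕ k) p} → RecursiveSet A → RecursiveSet (∁ A)
∁-recursiveSet {A = A} (χ , χ-rec , χ-A) = not ∘ χ , not-recursive χ-rec , λ v → reflects (χ-A v)
  where
  reflects : ∀ {x} {P : Set p} → Reflects x P → Reflects (not x) (¬ P)
  reflects (inj₁ (refl , P)) = inj₂ (refl , λ ¬P → ¬P P)
  reflects (inj₂ (refl , ¬P)) = inj₁ (refl , ¬P)

∩-recursiveSet : {A : Pred (Vec ℕ k) p} {B : Pred (Vec ℕ k) q} →
                 RecursiveSet A → RecursiveSet B → RecursiveSet (A ∩ B)
∩-recursiveSet (χ , χ-rec , χ-A) (ψ , ψ-rec , ψ-B) =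
  (λ v → and (χ v) (ψ v)) , and-recursive χ-rec ψ-rec , λ v → reflects (χ-A v) (ψ-B v)
  where
  reflects : ∀ {x y} {P : Set p} {Q : Set q} →
             Reflects x P → Reflects y Q → Reflects (and x y) (P × Q)
  reflects (inj₁ (refl , P))  (inj₁ (refl , Q))  = inj₁ (refl , P , Q)
  reflects (inj₁ (refl , P))  (inj₂ (refl , ¬Q)) = inj₂ (refl , ¬Q ∘ proj₂)
  reflects (inj₂ (refl , ¬P)) _                  = inj₂ (refl , ¬P ∘ proj₁)

or-reflects : ∀ {x y} {P : Set p} {Q : Set q} →
              Reflects x P → Reflects y Q → Reflects (or x y) (P ⊎ Q)
or-reflects (inj₁ (refl , P))  _                  = inj₁ (refl , inj₁ P)
or-reflects (inj₂ (refl , ¬P)) (inj₁ (refl , Q))  = inj₁ (refl , inj₂ Q)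
or-reflects (inj₂ (refl , ¬P)) (inj₂ (refl , ¬Q)) = inj₂ (refl , λ { (inj₁ P) → ¬P P ; (inj₂ Q) → ¬Q Q })

∪-recursiveSet : {A : Pred (Vec ℕ k) p} {B : Pred (Vec ℕ k) q} →
                 RecursiveSet A → RecursiveSet B → RecursiveSet (A ∪ B)
∪-recursiveSet (χ , χ-rec , χ-A) (ψ , ψ-rec , ψ-B) =
  (λ v → or (χ v) (ψ v)) , or-recursive χ-rec ψ-rec , λ v → or-reflects (χ-A v) (ψ-B v)

⋂-recursiveSet : {A : Fin n → Pred (Vec ℕ k) p} →
                 (∀ i → RecursiveSet (A i)) → RecursiveSet (λ v → ∀ i → A i v)
⋂-recursiveSet {n = zero}  A-rec = const 1 , const-recursive 1 , λ _ → inj₁ (refl , λ ())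
⋂-recursiveSet {n = suc n} A-rec =
  ≐-recursiveSet ((λ { (A₀ , A₊) zero → A₀ ; (A₀ , A₊) (suc i) → A₊ i }) , (λ Av → Av zero , Av ∘ suc))
                 (∩-recursiveSet (A-rec zero) (⋂-recursiveSet (A-rec ∘ suc)))

-- Bounded quantification and unbounded search

bounded-∃-recursiveSet : {A : Pred (Vec ℕ (suc k)) p} → RecursiveSet A →
  RecursiveSet {k = suc k} (λ v → ∃[ x ] (x < head v × A (x ∷ tail v)))
bounded-∃-recursiveSet {k = k} {p = p} {A = A} (χ , χ-rec , χ-A) =
  (λ v → any (head v) (tail v)) , any-recursive , λ v → any-reflects (head v) (tail v)
  where
  any : ℕ → Vec ℕ k → ℕ
  any zero    v = 0
  any (suc n) v = or (χ (n ∷ v)) (any n v)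

  -- In the recursion step the arguments are n, the value at n, and v.
  any-recursive : Recursive (λ v → any (head v) (tail v))
  any-recursive =
    prec (const-recursive 0)
         (or-recursive
           (∘-recursive χ-rec
             (∷-recursive (proj zero) (∘-recursiveVec tail-recursive tail-recursive)))
           (proj (suc zero)))
         (λ _ → refl) (λ _ _ → refl)

  any-reflects : ∀ n v → Reflects (any n v) (∃[ x ] (x < n × A (x ∷ v)))
  any-reflects zero    v = inj₂ (refl , λ ())
  any-reflects (suc n) v with or-reflects (χ-A (n ∷ v)) (any-reflects n v)
  ... | inj₁ (≡1 , inj₁ An)            = inj₁ (≡1 , n , n<1+n n , An)
  ... | inj₁ (≡1 , inj₂ (x , x<n , Ax)) = inj₁ (≡1 , x , m<n⇒m<1+n x<n , Ax)
  ... | inj₂ (≡0 , ¬A)                 = inj₂ (≡0 , ¬∃)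
    where
    ¬∃ : ¬ (∃[ x ] (x < suc n × A (x ∷ v)))
    ¬∃ (x , x<1+n , Ax) with m<1+n⇒m<n∨m≡n x<1+n
    ... | inj₁ x<n  = ¬A (inj₂ (x , x<n , Ax))
    ... | inj₂ refl = ¬A (inj₁ Ax)

-- The bound may depend recursively on the free variables.
bounded-∃Vec-recursiveSet : ∀ l {A : Pred (Vec ℕ (l + k)) p} {b : Vec ℕ k → ℕ} →
  Recursive b → RecursiveSet A →
  RecursiveSet {k = k} (λ v → ∃[ ys ] (All (_< b v) {l} ys × A (ys ++ v)))
bounded-∃Vec-recursiveSet zero b-rec A-rec =
  ≐-recursiveSet ((λ Av → [] , [] , Av) , λ { ([] , [] , Av) → Av }) A-rec
bounded-∃Vec-recursiveSet {k = k} {p = p} (suc l) {A} {b} b-rec A-rec =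
  ≐-recursiveSet (forward , backward) (bounded-∃Vec-recursiveSet l b-rec A₁-rec)
  where
  A₁ : Pred (Vec ℕ (l + k)) p
  A₁ w = ∃[ y ] (y < b (drop l w) × A (y ∷ w))

  A₁-rec : RecursiveSet A₁
  A₁-rec = preimage-recursiveSet
    (∷-recursive (∘-recursive b-rec (drop-recursive l)) id-recursive)
    (bounded-∃-recursiveSet A-rec)

  forward : ∀ {v} → ∃[ ys ] (All (_< b v) {l} ys × A₁ (ys ++ v)) →
            ∃[ ys ] (All (_< b v) {suc l} ys × A (ys ++ v))
  forward {v} (ys , ys<b , y , y<b , Ay) =
    y ∷ ys , subst (λ u → y < b u) (drop-++ ys v) y<b ∷ ys<b , Ay

  backward : ∀ {v} → ∃[ ys ] (All (_< b v) {suc l} ys × A (ys ++ v)) →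
             ∃[ ys ] (All (_< b v) {l} ys × A₁ (ys ++ v))
  backward {v} (y ∷ ys , y<b ∷ ys<b , Ay) =
    ys , ys<b , y , subst (λ u → y < b u) (sym (drop-++ ys v)) y<b , Ay

-- The values χ n decide P, so the least element of P lies at most n steps away.
least : {P : Pred ℕ p} {χ : ℕ → ℕ} → (∀ n → Reflects (χ n) (P n)) → ∀ n → P n →
        ∃[ m ] (P m × ∀ i → i < m → ¬ P i)
least χ-P n Pn with χ-P 0
least χ-P n       Pn | inj₁ (_ , P0)  = 0 , P0 , λ _ ()
least χ-P zero    P0 | inj₂ (_ , ¬P0) = ⊥-elim (¬P0 P0)
least χ-P (suc n) Pn | inj₂ (_ , ¬P0) with least (χ-P ∘ suc) n Pn
... | m , Pm , ¬P<m = suc m , Pm , λ { zero _ → ¬P0 ; (suc i) (s<s i<m) → ¬P<m i i<m }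

minimise : {A : Pred (Vec ℕ (suc k)) p} → RecursiveSet A → (∀ v → ∃[ x ] A (x ∷ v)) →
           Σ[ f ∈ (Vec ℕ k → ℕ) ] Recursive f × (∀ v → A (f v ∷ v))
minimise {k = k} {A = A} (χ , χ-rec , χ-A) total =
  -- Minimisation looks for a zero, hence the negated characteristic function.
  f , mini (not-recursive χ-rec) zero-at-f nonzero-below-f , proj₁ ∘ proj₂ ∘ minimum
  where
  minimum : ∀ v → ∃[ m ] (A (m ∷ v) × ∀ i → i < m → ¬ A (i ∷ v))
  minimum v = least (λ x → χ-A (x ∷ v)) (proj₁ (total v)) (proj₂ (total v))

  f : Vec ℕ k → ℕ
  f = proj₁ ∘ minimum

  zero-at-f : ∀ v → not (χ (f v ∷ v)) ≡ 0
  zero-at-f v with minimum v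
  ... | m , Am , _ with χ-A (m ∷ v)
  ...   | inj₁ (χ≡1 , _)  = cong not χ≡1
  ...   | inj₂ (_ , ¬Am) = ⊥-elim (¬Am Am)

  nonzero-below-f : ∀ v i → i < f v → not (χ (i ∷ v)) ≢ 0
  nonzero-below-f v i i<f with χ-A (i ∷ v)
  ... | inj₁ (_ , Ai)  = ⊥-elim (proj₂ (proj₂ (minimum v)) i i<f Ai)
  ... | inj₂ (χ≡0 , _) rewrite χ≡0 = λ ()

upperBound : (ys : Vec ℕ l) → ∃[ b ] All (_< b) ys
upperBound []       = 0 , []
upperBound (y ∷ ys) with upperBound ys
... | b , ys<b = suc y ⊔ b ,
  m≤m⊔n (suc y) b ∷ All.map (λ x<b → <-≤-trans x<b (m≤n⊔m (suc y) b)) ys<b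

-- Uniformisation of a projection: only z is required as a recursive function of v,
-- the auxiliary unknowns ys merely exist.
search : ∀ l {A : Pred (Vec ℕ (l + suc k)) p} → RecursiveSet A →
         (∀ v → ∃₂ λ (ys : Vec ℕ l) z → A (ys ++ z ∷ v)) →
         Σ[ f ∈ (Vec ℕ k → ℕ) ] Recursive f × (∀ v → ∃[ ys ] A (ys ++ f v ∷ v))
search {k = k} {p = p} l {A} A-rec total = f , f-rec , f-solves
  where
  -- Deletion of the bound b from the tuple (z, b, v).
  forget : Vec ℕ (suc (suc k)) → Vec ℕ (suc k)
  forget w = head w ∷ tail (tail w)

  forget-recursive : RecursiveVec forget
  forget-recursive =
    ∷-recursive head-recursive (∘-recursiveVec tail-recursive tail-recursive)

  -- z belongs to a solution over v whose other entries are below b.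
  Solution : Pred (Vec ℕ (suc (suc k))) p
  Solution w = ∃[ ys ] (All (_< head (tail w)) {l} ys × A (under l forget (ys ++ w)))

  solution-recursive : RecursiveSet Solution
  solution-recursive = bounded-∃Vec-recursiveSet l
    (∘-recursive head-recursive tail-recursive)
    (preimage-recursiveSet (under-recursive l forget-recursive) A-rec)

  solution : ∀ {z b v} (ys : Vec ℕ l) → All (_< b) ys → A (ys ++ z ∷ v) → Solution (z ∷ b ∷ v)
  solution {z} {b} {v} ys ys<b Ay =
    ys , ys<b , subst A (sym (under-++ forget ys (z ∷ b ∷ v))) Ay

  Bound : Pred (Vec ℕ (suc k)) p
  Bound w = ∃[ z ] (z < head w × Solution (z ∷ w))

  bound-recursive : RecursiveSet Bound
  bound-recursive = preimage-recursiveSet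
    (∷-recursive head-recursive id-recursive)
    (bounded-∃-recursiveSet solution-recursive)

  bound-exists : ∀ v → ∃[ b ] Bound (b ∷ v)
  bound-exists v with total v
  ... | ys , z , Ay with upperBound (z ∷ ys)
  ...   | b , z<b ∷ ys<b = b , z , z<b , solution ys ys<b Ay

  -- β v is a strict upper bound for the entries of some solution over v.
  β-min : Σ[ β ∈ (Vec ℕ k → ℕ) ] Recursive β × (∀ v → Bound (β v ∷ v))
  β-min = minimise bound-recursive bound-exists

  β : Vec ℕ k → ℕ
  β = proj₁ β-min

  f-min : Σ[ f ∈ (Vec ℕ k → ℕ) ] Recursive f × (∀ v → Solution (f v ∷ β v ∷ v))
  f-min = minimise
    (preimage-recursiveSet
      {F = λ w → head w ∷ β (tail w) ∷ tail w}
      (∷-recursive head-recursive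
        (∷-recursive (∘-recursive (proj₁ (proj₂ β-min)) tail-recursive) tail-recursive))
      solution-recursive)
    (λ v → let z , _ , Sz = proj₂ (proj₂ β-min) v in z , Sz)

  f : Vec ℕ k → ℕ
  f = proj₁ f-min

  f-rec : Recursive f
  f-rec = proj₁ (proj₂ f-min)

  f-solves : ∀ v → ∃[ ys ] A (ys ++ f v ∷ v)
  f-solves v with proj₂ (proj₂ f-min) v
  ... | ys , _ , Ay = ys , subst A (under-++ forget ys (f v ∷ β v ∷ v)) Ay

-- Recursive subsets of a coded set

module _ {A : Setoid a ℓ} (j : Coding A) where
  open Setoid A using (Carrier)
  open VecEquality A using (_≋_; []; _∷_)
  open Injection j using (to; injective)

  map-injective : ∀ {v w : Vec Carrier k} → map to v ≡ map to w → v ≋ w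
  map-injective {v = []}    {[]}    _  = []
  map-injective {v = x ∷ v} {y ∷ w} eq =
    injective (∷-injectiveˡ eq) ∷ map-injective (∷-injectiveʳ eq)

  -- The choice of a preimage is immaterial, as codes are injective up to equality.
  Image-reflects : {S : Pred (Vec Carrier k) p} → S Respects _≋_ →
                   ∀ {v} → Image j S (map to v) → S v
  Image-reflects S-resp (w , Sw , eq) = S-resp (map-injective eq) Sw

  codes-recursive : RecursiveSubset j {k = 1} U → ∀ k → RecursiveSubset j {k = k} U
  codes-recursive im zero    =
    const 1 , const-recursive 1 , λ { [] → inj₁ (refl , [] , tt , refl) }
  codes-recursive im (suc k) =
    ≐-recursiveSet (combine , split)
      (∩-recursiveSet
        (preimage-recursiveSet {F = λ v → [ head v ]} (∷-recursive head-recursive []-recursive) im)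
        (preimage-recursiveSet tail-recursive (codes-recursive im k)))
    where
    combine : ∀ {v} → Image j {k = 1} U [ head v ] × Image j U (tail v) → Image j U v
    combine {n ∷ v} ((x ∷ [] , _ , x↦n) , (w , _ , w↦v)) =
      x ∷ w , tt , cong₂ _∷_ (∷-injectiveˡ x↦n) w↦v

    split : ∀ {v} → Image j U v → Image j {k = 1} U [ head v ] × Image j U (tail v)
    split (x ∷ w , _ , refl) = ([ x ] , tt , refl) , (w , tt , refl)

  ⋂-recursiveSubset : RecursiveSubset j {k = 1} U →
    {S : Fin n → Pred (Vec Carrier k) p} → (∀ i → S i Respects _≋_) →
    (∀ i → RecursiveSubset j (S i)) → RecursiveSubset j (λ v → ∀ i → S i v)
  ⋂-recursiveSubset {k = k} im {S} S-resp S-rec =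
    ≐-recursiveSet (combine , split)
      (∩-recursiveSet (codes-recursive im k) (⋂-recursiveSet S-rec))
    where
    -- The code v itself must be that of a tuple, as there may be no i.
    combine : ∀ {v} → Image j U v × (∀ i → Image j (S i) v) → Image j (λ w → ∀ i → S i w) v
    combine ((w , _ , refl) , Sv) = w , (λ i → Image-reflects (S-resp i) (Sv i)) , refl

    split : ∀ {v} → Image j (λ w → ∀ i → S i w) v → Image j U v × (∀ i → Image j (S i) v)
    split (w , Sw , eq) = (w , tt , eq) , λ i → w , Sw i , eq

-- Terms and basic formulas

module _ {s c ℓ p : Level} {L : Language s} {R : RecursiveRing c ℓ}
         (I : RecursiveInterpretation p L R) where
  open RecursiveRing R using (Carrier; ≈-setoid; _≈_; code; image-recursive)
  open RecursiveInterpretation I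
  open VecEquality ≈-setoid using (_≋_; []; _∷_)
  open Injection code using (to)
  open Setoid ≈-setoid using () renaming (refl to ≈-refl)

  mutual
    evalTerm-cong : ∀ {ρ σ : Vec Carrier n} → ρ ≋ σ →
                    (t : Term L n) → evalTerm I ρ t ≈ evalTerm I σ t
    evalTerm-cong ρ≋σ (var i)    = lookup-cong ρ≋σ i
      where
      lookup-cong : ∀ {n} {ρ σ : Vec Carrier n} → ρ ≋ σ → ∀ i → lookup ρ i ≈ lookup σ i
      lookup-cong (x≈y ∷ _)   zero    = x≈y
      lookup-cong (_   ∷ ρ≋σ) (suc i) = lookup-cong ρ≋σ i
    evalTerm-cong ρ≋σ (con _)    = ≈-refl
    evalTerm-cong ρ≋σ (app f ts) = Func.cong ⟦ f ⟧ᶠ (evalTerms-cong ρ≋σ ts)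

    evalTerms-cong : ∀ {ρ σ : Vec Carrier n} → ρ ≋ σ →
                     (ts : Vec (Term L n) k) → evalTerms I ρ ts ≋ evalTerms I σ ts
    evalTerms-cong ρ≋σ []       = []
    evalTerms-cong ρ≋σ (t ∷ ts) = evalTerm-cong ρ≋σ t ∷ evalTerms-cong ρ≋σ ts

  Holds-respects : (f : BasicFormula L n) → Holds I f Respects _≋_
  Holds-respects (rel r ts) ρ≋σ = rel-respects r (evalTerms-cong ρ≋σ ts)

  mutual
    evalTerm-recursive : (t : Term L n) → RecursiveOperation code code (λ ρ → evalTerm I ρ t)
    evalTerm-recursive (var i)    = (λ v → lookup v i) , proj i , λ ρ → lookup-map i to ρ
    evalTerm-recursive (con a)    = const (to ⟦ a ⟧ᶜ) , const-recursive _ , λ _ → refl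
    evalTerm-recursive (app f ts) with fun-recursive f | evalTerms-recursive ts
    ... | g , g-rec , g-f | G , G-rec , G-ts =
      g ∘ G , ∘-recursive g-rec G-rec ,
      λ ρ → trans (cong g (G-ts ρ)) (g-f (evalTerms I ρ ts))

    evalTerms-recursive : (ts : Vec (Term L n) k) →
      Σ[ G ∈ (Vec ℕ n → Vec ℕ k) ]
        RecursiveVec G × (∀ ρ → G (map to ρ) ≡ map to (evalTerms I ρ ts))
    evalTerms-recursive []       = const [] , []-recursive , λ _ → refl
    evalTerms-recursive (t ∷ ts) with evalTerm-recursive t | evalTerms-recursive ts
    ... | g , g-rec , g-t | G , G-rec , G-ts =
      (λ v → g v ∷ G v) , ∷-recursive g-rec G-rec , λ ρ → cong₂ _∷_ (g-t ρ) (G-ts ρ)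

  Holds-recursive : (f : BasicFormula L n) → RecursiveSubset code (Holds I f)
  Holds-recursive {n = n} (rel r ts) with evalTerms-recursive ts
  ... | G , G-rec , G-ts =
    ≐-recursiveSet (forward , backward)
      (∩-recursiveSet (codes-recursive code image-recursive n)
                      (preimage-recursiveSet G-rec (rel-recursive r)))
    where
    forward : ∀ {v} → Image code U v × Image code ⟦ r ⟧ʳ (G v) → Image code (Holds I (rel r ts)) v
    forward ((ρ , _ , refl) , Rv) =
      ρ , Image-reflects code (rel-respects r) (subst (Image code ⟦ r ⟧ʳ) (G-ts ρ) Rv) , refl

    backward : ∀ {v} → Image code (Holds I (rel r ts)) v → Image code U v × Image code ⟦ r ⟧ʳ (G v)
    backward (ρ , Rρ , refl) = (ρ , tt , refl) , (evalTerms I ρ ts , Rρ , sym (G-ts ρ))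

lemma6p29 : ∀ {c₁ ℓ₁ c₂ ℓ₂ s₁ s₂ p₁ p₂ : Level}
    (R₁ : RecursiveRing c₁ ℓ₁) (L₁ : Language s₁) (I₁ : RecursiveInterpretation p₁ L₁ R₁)
    (R₂ : RecursiveRing c₂ ℓ₂) (L₂ : Language s₂) (I₂ : RecursiveInterpretation p₂ L₂ R₂)
    (φ : Bijection (RecursiveRing.≈-setoid R₁) (RecursiveRing.≈-setoid R₂)) →
    RecursiveMap R₁ R₂ (Bijection.to φ) →
    (d : Func (RecursiveRing.≈-setoid R₁) (RecursiveRing.≈-setoid R₂)) →
    DiophantineIn R₁ R₂ I₂ (Bijection.to φ) (Func.to d) →
    RecursiveMap R₁ R₂ (Func.to d)
lemma6p29 {p₂ = p₂} R₁ L₁ I₁ R₂ L₂ I₂ φ (φ̂ , φ̂-rec , φ̂-φ) d (n , l , f , d-def) =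
  proj₁ d̂ , proj₁ (proj₂ d̂) , λ { (x ∷ []) → Target-sound (proj₂ (proj₂ d̂) [ j₁.to x ]) }
  where
  open RecursiveRing R₁ using () renaming (Carrier to X; code to j₁; image-recursive to im₁)
  open RecursiveRing R₂ using (≈-setoid; _≈_) renaming (Carrier to Y; code to j₂; image-recursive to im₂)
  open VecEquality ≈-setoid using (_∷_; ≋-refl)
  module φ = Bijection φ
  module d = Func d
  module j₁ = Injection j₁
  module j₂ = Injection j₂

  -- The Diophantine system that defines d, in the unknowns (φ x, ys, z).
  Solves : Pred (Vec Y (suc (suc l))) p₂
  Solves ρ = ∀ i → Holds I₂ (f i) ρ

  Solves-recursive : RecursiveSubset j₂ Solves
  Solves-recursive =
    ⋂-recursiveSubset j₂ im₂ (λ i → Holds-respects I₂ (f i)) (λ i → Holds-recursive I₂ (f i))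

  -- A tuple of the form (ys, z, n) is rearranged to (φ̂ n, ys, z).
  arrange : Vec ℕ (l + 2) → Vec ℕ (suc (suc l))
  arrange w = φ̂ (tail (drop l w)) ∷ (take l w ∷ʳ head (drop l w))

  arrange-++ : ∀ ys z v → arrange (ys ++ z ∷ v) ≡ φ̂ v ∷ (ys ∷ʳ z)
  arrange-++ ys z v =
    cong₂ (λ ys′ v′ → φ̂ (tail v′) ∷ (ys′ ∷ʳ head v′)) (take-++ ys (z ∷ v)) (drop-++ ys (z ∷ v))

  arrange-recursive : RecursiveVec arrange
  arrange-recursive =
    ∷-recursive (∘-recursive φ̂-rec (∘-recursiveVec tail-recursive (drop-recursive l)))
      (∷ʳ-recursive (take-recursive l) (∘-recursive head-recursive (drop-recursive l)))

  -- The set that is searched, in the variables (ys, z, n).  The first alternative makes the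
  -- search succeed also when n is not a code.
  Target : Pred (Vec ℕ (l + 2)) _
  Target w = ¬ Image j₁ {k = 1} U (tail (drop l w)) ⊎ Image j₂ Solves (arrange w)

  Target-recursive : RecursiveSet Target
  Target-recursive = ∪-recursiveSet
    (preimage-recursiveSet (∘-recursiveVec tail-recursive (drop-recursive l)) (∁-recursiveSet im₁))
    (preimage-recursiveSet arrange-recursive Solves-recursive)

  Target-total : ∀ v → ∃₂ λ (ys : Vec ℕ l) z → Target (ys ++ z ∷ v)
  Target-total v with proj₂ (proj₂ im₁) v
  ... | inj₂ (_ , v∉im) =
    ys₀ , 0 , inj₁ (subst (λ w → ¬ Image j₁ U (tail w)) (sym (drop-++ ys₀ (0 ∷ v))) v∉im)
    where
    ys₀ : Vec ℕ l
    ys₀ = replicate l 0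
  ... | inj₁ (_ , x ∷ [] , _ , refl) with Equivalence.to (d-def x (d.to x)) (Setoid.refl ≈-setoid)
  ...   | ys , solves = map j₂.to ys , j₂.to (d.to x) ,
    inj₂ (φ.to x ∷ (ys ∷ʳ d.to x) , solves ,
          trans (cong₂ _∷_ (sym (φ̂-φ [ x ])) (map-∷ʳ j₂.to (d.to x) ys))
                (sym (arrange-++ (map j₂.to ys) (j₂.to (d.to x)) [ j₁.to x ])))

  d̂ : Σ[ g ∈ (Vec ℕ 1 → ℕ) ] Recursive g × (∀ v → ∃[ ys ] Target (ys ++ g v ∷ v))
  d̂ = search l Target-recursive Target-total

  Solves-sound : ∀ {x z ρ} (ys : Vec ℕ l) → Solves ρ →
                 map j₂.to ρ ≡ φ̂ [ j₁.to x ] ∷ (ys ∷ʳ z) → z ≡ j₂.to (d.to x)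
  Solves-sound {x} {z} {r ∷ ρ} ys solves eq with initLast ρ
  ... | ys′ , z′ , refl = trans (sym z′↦z) (sym (j₂.cong dx≈z′))
    where
    z′↦z : j₂.to z′ ≡ z
    z′↦z = ∷ʳ-injectiveʳ (map j₂.to ys′) ys
             (trans (sym (map-∷ʳ j₂.to z′ ys′)) (∷-injectiveʳ eq))

    r≈φx : r ≈ φ.to x
    r≈φx = j₂.injective (trans (∷-injectiveˡ eq) (φ̂-φ [ x ]))

    dx≈z′ : d.to x ≈ z′
    dx≈z′ = Equivalence.from (d-def x z′)
      (ys′ , λ i → Holds-respects I₂ (f i) (r≈φx ∷ ≋-refl) (solves i))

  -- Uniqueness: whatever the search finds over the code of x is the code of d x.
  Target-sound : ∀ {x z} → ∃[ ys ] Target (ys ++ z ∷ [ j₁.to x ]) → z ≡ j₂.to (d.to x)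
  Target-sound {x} (ys , inj₁ n∉im) = ⊥-elim
    (subst (λ w → ¬ Image j₁ U (tail w)) (drop-++ ys _) n∉im ([ x ] , tt , refl))
  Target-sound {x} (ys , inj₂ (ρ , solves , eq)) =
    Solves-sound ys solves (trans eq (arrange-++ ys _ [ j₁.to x ]))
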